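{- Let $0\le d\le N$ be integers. If $d=0$ or $d=N$ then $\dim\Lambda_{N,d}=0$; otherwise $\dim\Lambda_{N,d}=(d-1)(N-d-1)$.
   Context: For integers $0\le d\le N$, $\Lambda_{N,d}\subseteq\mathbb{R}^{d\times(N+1)}$ denotes the set of real matrices $\lambda=(\lambda_{i,n})$, with rows indexed by $1\le i\le d$ and columns indexed by $0\le n\le N$, satisfying: $\lambda_{i,0}=0$ for $1\le i\le d$; $\lambda_{i,N}=N$ for $1\le i\le d$; $\sum_{i=1}^d\lambda_{i,n}=dn$ for $0\le n\le N$; $\lambda_{i,n}\le\lambda_{i,n+1}$ for $1\le i\le d$, $0\le n<N$; $\lambda_{i,n}\le\lambda_{i-1,n-1}$ for $1<i\le d$, $0<n\le N$. (For $d=0$ this is the single empty $0\times(N+1)$ matrix.) The dimension of a polytope is the dimension of its affine hull. -}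

module Defs where

open import Level using (Level; _⊔_) renaming (suc to lsuc)
open import Data.Nat.Base as ℕ using (ℕ; suc)
open import Data.Fin.Base using (Fin; zero; suc; toℕ; fromℕ; inject₁)
open import Data.Vec.Functional using (Vector)
open import Data.Product.Base using (∃-syntax; Σ-syntax; _×_)
open import Data.Sum.Base using (_⊎_)
open import Relation.Nullary.Negation using (¬_)
open import Relation.Unary using (Pred; _≐_)
open import Relation.Binary.Core using (Rel)
open import Relation.Binary.Structures using (IsStrictPartialOrder)
open import Relation.Binary.PropositionalEquality.Core using (_≡_)
open import Algebra.Bundles using (CommutativeRing)
open import Algebra.Apartness.Bundles using (HeytingCommutativeRing; HeytingField)
import Algebra.Properties.Semiring.Mult as Mult
import Algebra.Properties.Semiring.Sum as Sum

private
  variable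
    ℓ : Level

-- The real numbers, given by their axioms: an Archimedean, Cauchy complete
-- ordered field (classically unique up to isomorphism).  The axioms are in
-- constructive form: x ≤ y means ¬ (y < x), and neither trichotomy nor
-- decidability of the order is assumed.
record RealNumbers c ℓ₁ ℓ₂ ℓ₃ : Set (lsuc (c ⊔ ℓ₁ ⊔ ℓ₂ ⊔ ℓ₃)) where
  infix 4 _<_ _≤_
  field
    heytingField : HeytingField c ℓ₁ ℓ₂

  open HeytingField heytingField public
    hiding (zero) renaming (Carrier to ℝ)
  open HeytingCommutativeRing heytingCommutativeRing public
    using (commutativeRing)
  open CommutativeRing commutativeRing public
    using (semiring)
  open Sum semiring public
    using (sum)

  field
    _<_                  : Rel ℝ ℓ₃
    isStrictPartialOrder : IsStrictPartialOrder _≈_ _<_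
    <⇒#                  : ∀ {x y} → x < y → x # y
    #⇒<⊎>                : ∀ {x y} → x # y → x < y ⊎ y < x
    +-monoˡ-<            : ∀ {x y} z → x < y → x + z < y + z
    *-pos                : ∀ {x y} → 0# < x → 0# < y → 0# < x * y

  _≤_ : Rel ℝ ℓ₃
  x ≤ y = ¬ (y < x)

  ι : ℕ → ℝ
  ι n = Mult._×_ semiring n 1#

  -- Both one-sided bounds on s m - s n are covered, as m and n can be swapped.
  IsCauchy : (ℕ → ℝ) → Set (c ⊔ ℓ₃)
  IsCauchy s = ∀ ε → 0# < ε →
    ∃[ M ] (∀ m n → M ℕ.≤ m → M ℕ.≤ n → s m - s n < ε)

  ConvergesTo : (ℕ → ℝ) → ℝ → Set (c ⊔ ℓ₃)
  ConvergesTo s l = ∀ ε → 0# < ε →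
    ∃[ M ] (∀ n → M ℕ.≤ n → (s n - l < ε) × (l - s n < ε))

  field
    archimedean : ∀ x → ∃[ n ] (x < ι n)
    complete    : ∀ s → IsCauchy s → ∃[ l ] ConvergesTo s l


module _ {c ℓ₁ ℓ₂ ℓ₃} (R : RealNumbers c ℓ₁ ℓ₂ ℓ₃) where
  open RealNumbers R

  Matrix : ℕ → ℕ → Set c
  Matrix m n = Fin m → Fin n → ℝ

  module _ {m n : ℕ} where

    infix 4 _≈ᴹ_

    _≈ᴹ_ : Rel (Matrix m n) ℓ₁
    A ≈ᴹ B = ∀ i j → A i j ≈ B i j

    0ᴹ : Matrix m n
    0ᴹ i j = 0#

    _-ᴹ_ : Matrix m n → Matrix m n → Matrix m n
    (A -ᴹ B) i j = A i j - B i j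

    combination : ∀ {k} → Vector ℝ k → Vector (Matrix m n) k → Matrix m n
    combination a v i j = sum (λ t → a t * v t i j)

    AffineHull : Pred (Matrix m n) ℓ → Pred (Matrix m n) (c ⊔ ℓ₁ ⊔ ℓ)
    AffineHull S x =
      ∃[ k ] Σ[ a ∈ Vector ℝ k ] Σ[ p ∈ Vector (Matrix m n) k ]
        (∀ t → S (p t)) × (sum a ≈ 1#) × (x ≈ᴹ combination a p)

    Span : ∀ {k} → Vector (Matrix m n) k → Pred (Matrix m n) (c ⊔ ℓ₁)
    Span v x = ∃[ a ] (x ≈ᴹ combination a v)

    LinearlyIndependent : ∀ {k} → Vector (Matrix m n) k → Set (c ⊔ ℓ₁)
    LinearlyIndependent v = ∀ a → combination a v ≈ᴹ 0ᴹ → ∀ t → a t ≈ 0#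

    HasLinearDim : Pred (Matrix m n) ℓ → ℕ → Set (c ⊔ ℓ₁ ⊔ ℓ)
    HasLinearDim V k =
      Σ[ b ∈ Vector (Matrix m n) k ] LinearlyIndependent b × (V ≐ Span b)

    Direction : Pred (Matrix m n) ℓ → Pred (Matrix m n) (c ⊔ ℓ₁ ⊔ ℓ)
    Direction A v = ∃[ x ] ∃[ y ] A x × A y × (v ≈ᴹ (y -ᴹ x))

    -- The dimension of an affine subspace is that of its space of differences.
    -- The empty set has no dimension in this sense, since its set of
    -- differences does not contain 0ᴹ.
    HasAffineDim : Pred (Matrix m n) ℓ → ℕ → Set (c ⊔ ℓ₁ ⊔ ℓ)
    HasAffineDim A k = HasLinearDim (Direction A) k

    HasDim : Pred (Matrix m n) ℓ → ℕ → Set (c ⊔ ℓ₁ ⊔ ℓ)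
    HasDim P k = HasAffineDim (AffineHull P) k

  -- Rows are numbered from 0 here, so that λ_{i,n} is  M i' n  with
  -- toℕ i' = i - 1; columns are numbered 0, …, N as usual.
  record Λ (N d : ℕ) (M : Matrix d (suc N)) : Set (ℓ₁ ⊔ ℓ₃) where
    field
      firstColumn : ∀ i → M i zero ≈ 0#
      lastColumn  : ∀ i → M i (fromℕ N) ≈ ι N
      columnSum   : ∀ n → sum (λ i → M i n) ≈ ι (d ℕ.* toℕ n)
      horizontal  : ∀ i (n : Fin N) → M i (inject₁ n) ≤ M i (suc n)
      diagonal    : ∀ (i i⁻ : Fin d) → toℕ i ≡ suc (toℕ i⁻) →
                    ∀ (n : Fin N) → M i (suc n) ≤ M i⁻ (inject₁ n)

-- Write N = d + m and number the rows from 0.  The inequalities force λ i n = 0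
-- for n ≤ i and λ i n = N for n > m + i; apart from these entries, only the
-- column sums restrict the affine hull.  Indeed, the point with the remaining
-- entries λ i n = d + n − 1 − 2i is integral, and all inequalities that involve
-- a remaining entry hold there with a gap of at least 1.  Adding 1 at (i − 1, n)
-- and subtracting 1 at (i, n), both of them remaining entries, narrows each gap by
-- at most 1 (no single inequality relates the two), so the resulting point stays
-- inside the polytope, and these (d − 1)(m − 1) differences are a basis of the
-- direction space: the coordinates of a vector are the partial sums of its columns.

module Submission where

open import Defs
open import Data.Nat.Base using (ℕ; _≤_; _*_; _∸_)
open import Data.Product.Base using (_×_)
open import Data.Sum.Base using (_⊎_)
open import Relation.Nullary.Negation using (¬_)
open import Relation.Binary.PropositionalEquality.Core using (_≡_)

open import Level using (_⊔_)
open import Data.Nat.Base as ℕ using (zero; suc; z≤n; s≤s; _⊓_)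
import Data.Nat.Properties as ℕ
open import Data.Nat.Solver using (module +-*-Solver)
open import Data.Fin.Base
  using (Fin; zero; suc; toℕ; fromℕ; fromℕ<; inject₁; combine; quotient; remainder)
import Data.Fin.Properties as Fin
open import Data.Fin.Induction using (<-weakInduction; >-weakInduction)
open import Data.Vec.Functional using (Vector; tail; _∷_)
open import Data.Product.Base using (∃-syntax; _,_; proj₁; proj₂)
open import Data.Sum.Base using (inj₁; inj₂; [_,_]′)
open import Data.Empty using (⊥)
open import Function.Base using (_∘_)
open import Relation.Nullary using (Dec; yes; no; contradiction; _×-dec_)
open import Relation.Binary.PropositionalEquality as ≡ using (cong; cong₂; subst; module ≡-Reasoning)
import Algebra.Properties.CommutativeSemigroup as CommutativeSemigroupProperties
import Algebra.Properties.Ring as RingProperties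
import Algebra.Properties.Semiring.Sum as SumProperties
import Algebra.Properties.Semiring.Mult as MultProperties
import Algebra.Apartness.Properties.HeytingCommutativeRing as HeytingProperties
open import Relation.Binary.Structures using (IsStrictPartialOrder)
import Relation.Binary.Reasoning.Setoid as SetoidReasoning
open import Algebra.Bundles using (CommutativeRing)

-- Indicators of decidable propositions.

ind : ∀ {a} {A : Set a} → Dec A → ℕ
ind (yes _) = 1
ind (no  _) = 0

ind-yes : ∀ {a} {A : Set a} (A? : Dec A) → A → ind A? ≡ 1
ind-yes (yes _) _ = ≡.refl
ind-yes (no ¬a) a = contradiction a ¬a

ind-no : ∀ {a} {A : Set a} (A? : Dec A) → ¬ A → ind A? ≡ 0
ind-no (yes a) ¬a = contradiction a ¬a
ind-no (no  _) _  = ≡.refl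

-- At most one indicator equals 1, and then the strict gap has room for it. In use, `x` and `y` are
-- the two sides of an inequality at the special point; one indicator raises `x`, the other lowers
-- `y`.
gap-absorbs-indicators : ∀ {a b} {A : Set a} {B : Set b} (A? : Dec A) (B? : Dec B) {x y : ℕ} →
  ¬ (A × B) → (A ⊎ B → x ℕ.< y) → x ≤ y → (x ℕ.+ ind A?) ℕ.+ ind B? ≤ y
gap-absorbs-indicators (yes a) (yes b) ¬ab _   _   = contradiction (a , b) ¬ab
gap-absorbs-indicators (yes a) (no  _) {x} {y} _ gap _ =
  subst (_≤ y) (≡.trans (ℕ.+-comm 1 x) (≡.sym (ℕ.+-identityʳ (x ℕ.+ 1)))) (gap (inj₁ a))
gap-absorbs-indicators (no  _) (yes b) {x} {y} _ gap _ =
  subst (_≤ y) (≡.trans (ℕ.+-comm 1 x) (cong (ℕ._+ 1) (≡.sym (ℕ.+-identityʳ x)))) (gap (inj₂ b))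
gap-absorbs-indicators (no  _) (no  _) {x} {y} _ _ x≤y =
  subst (_≤ y) (≡.sym (≡.trans (ℕ.+-identityʳ (x ℕ.+ 0)) (ℕ.+-identityʳ x))) x≤y

-- Integer points: the special point and its perturbations.

module Eigensteps (d m : ℕ) where

  -- `i` marks the boundary between rows `i - 1` and `i`: the bounds say that both rows exist and
  -- that both entries in column `n` are remaining ones.
  Interior : ℕ → ℕ → Set
  Interior i n = (0 ℕ.< i × i ℕ.< d) × (i ℕ.< n × n ℕ.< i ℕ.+ m)

  -- The entries of the special point in the coordinates D = d − i and k = n − i,
  -- in which the diagonal inequality is monotonicity in D.
  skewed : ℕ → ℕ → ℕ
  skewed D zero = 0
  skewed D (suc k) with k ℕ.<? m
  ... | yes _ = D ℕ.+ k
  ... | no  _ = d ℕ.+ m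

  skewed-monoˡ : ∀ {D E} k → D ≤ E → skewed D k ≤ skewed E k
  skewed-monoˡ zero D≤E = z≤n
  skewed-monoˡ (suc k) D≤E with k ℕ.<? m
  ... | yes _ = ℕ.+-monoˡ-≤ k D≤E
  ... | no  _ = ℕ.≤-refl

  skewed-strictˡ : ∀ {D E} k → 0 ℕ.< k → k ≤ m → D ℕ.< E → skewed D k ℕ.< skewed E k
  skewed-strictˡ (suc k) _ k<m D<E with k ℕ.<? m
  ... | yes _   = ℕ.+-monoˡ-< k D<E
  ... | no  k≮m = contradiction k<m k≮m

  -- For `m > 0` the range of `k` includes both boundary steps, from the forced 0 to `D` and from
  -- `D + m - 1` to the forced `d + m`; the latter is strict because `D ≤ d`.
  skewed-strictʳ : ∀ {D} k → 0 ℕ.< D → D ≤ d → k ≤ m → skewed D k ℕ.< skewed D (suc k)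
  skewed-strictʳ {D} zero 0<D D≤d _ with 0 ℕ.<? m
  ... | yes _ = ℕ.<-≤-trans 0<D (ℕ.m≤m+n D 0)
  ... | no  _ = ℕ.<-≤-trans 0<D (ℕ.≤-trans D≤d (ℕ.m≤m+n d m))
  skewed-strictʳ {D} (suc k) 0<D D≤d k<m with k ℕ.<? m | suc k ℕ.<? m
  ... | yes _ | yes _ = ℕ.+-monoʳ-< D (ℕ.n<1+n k)
  ... | yes _ | no  _ = ℕ.+-mono-≤-< D≤d k<m
  ... | no k≮m | _    = contradiction k<m k≮m

  skewed-top : ∀ D k → m ℕ.< k → skewed D k ≡ d ℕ.+ m
  skewed-top D (suc k) (s≤s m≤k) with k ℕ.<? m
  ... | yes k<m = contradiction m≤k (ℕ.<⇒≱ k<m)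
  ... | no  _   = ≡.refl

  skewed-monoʳ : ∀ {D} k → 0 ℕ.< D → D ≤ d → skewed D k ≤ skewed D (suc k)
  skewed-monoʳ {D} k 0<D D≤d with k ℕ.≤? m
  ... | yes k≤m = ℕ.<⇒≤ (skewed-strictʳ k 0<D D≤d k≤m)
  ... | no  k≰m = ℕ.≤-reflexive (≡.trans (skewed-top D k (ℕ.≰⇒> k≰m))
                    (≡.sym (skewed-top D (suc k) (ℕ.m≤n⇒m≤1+n (ℕ.≰⇒> k≰m)))))

  skewed-pos : ∀ {D} k → 0 ℕ.< D → D ≤ d → 0 ℕ.< k → 0 ℕ.< skewed D k
  skewed-pos (suc k) 0<D D≤d _ with k ℕ.<? m
  ... | yes _ = ℕ.<-≤-trans 0<D (ℕ.m≤m+n _ k)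
  ... | no  _ = ℕ.<-≤-trans 0<D (ℕ.≤-trans D≤d (ℕ.m≤m+n d m))

  -- Truncation sends every `n ≤ i` to `k = 0`, which yields the forced zeros.
  special : ℕ → ℕ → ℕ
  special i n = skewed (d ∸ i) (n ∸ i)

  -- The closed form of the sum of the first i entries in column n of the special
  -- point, for i ≤ d.
  potential : ℕ → ℕ → ℕ
  potential i n = (i ⊓ n) * (d ℕ.+ (n ∸ i) ⊓ m)

  -- The window `i ≤ n ≤ i + m` covers every step that starts or ends at a remaining entry.
  special-horizontal-strict : ∀ {i n} → i ℕ.< d → i ≤ n → n ≤ i ℕ.+ m → special i n ℕ.< special i (suc n)
  special-horizontal-strict {i} {n} i<d i≤n n≤i+m rewrite ℕ.+-∸-assoc 1 i≤n =
    skewed-strictʳ (n ∸ i) (ℕ.m<n⇒0<n∸m i<d) (ℕ.m∸n≤m d i)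
      (ℕ.≤-trans (ℕ.∸-monoˡ-≤ i n≤i+m) (ℕ.≤-reflexive (ℕ.m+n∸m≡n i m)))

  special-horizontal : ∀ {i} n → i ℕ.< d → special i n ≤ special i (suc n)
  special-horizontal {i} n i<d with i ℕ.≤? n
  ... | yes i≤n rewrite ℕ.+-∸-assoc 1 i≤n =
        skewed-monoʳ (n ∸ i) (ℕ.m<n⇒0<n∸m i<d) (ℕ.m∸n≤m d i)
  ... | no  i≰n rewrite ℕ.m≤n⇒m∸n≡0 (ℕ.<⇒≤ (ℕ.≰⇒> i≰n)) = z≤n

  -- Both positions share `k = n - i`, so they are remaining entries together and only `D` changes.
  special-diagonal-strict : ∀ {i n} → i ℕ.< d → i ℕ.< n → n ≤ i ℕ.+ m →
    special (suc i) (suc n) ℕ.< special i n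
  special-diagonal-strict {i} {n} i<d i<n n≤i+m =
    skewed-strictˡ (n ∸ i) (ℕ.m<n⇒0<n∸m i<n)
      (ℕ.≤-trans (ℕ.∸-monoˡ-≤ i n≤i+m) (ℕ.≤-reflexive (ℕ.m+n∸m≡n i m)))
      (ℕ.∸-monoʳ-< (ℕ.n<1+n i) i<d)

  special-diagonal : ∀ i n → special (suc i) (suc n) ≤ special i n
  special-diagonal i n = skewed-monoˡ (n ∸ i) (ℕ.∸-monoʳ-≤ d (ℕ.n≤1+n i))

  special-pos : ∀ {i n} → i ℕ.< d → i ℕ.< n → 0 ℕ.< special i n
  special-pos {i} {n} i<d i<n =
    skewed-pos (n ∸ i) (ℕ.m<n⇒0<n∸m i<d) (ℕ.m∸n≤m d i) (ℕ.m<n⇒0<n∸m i<n)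

  special-first : ∀ i → special i 0 ≡ 0
  special-first i rewrite ℕ.0∸n≡0 i = ≡.refl

  special-last : ∀ {i} → i ℕ.< d → special i (d ℕ.+ m) ≡ d ℕ.+ m
  special-last {i} i<d = skewed-top (d ∸ i) (d ℕ.+ m ∸ i)
    (ℕ.m+n≤o⇒m≤o∸n (suc m) (subst (_≤ d ℕ.+ m) (cong suc (ℕ.+-comm i m)) (ℕ.+-monoˡ-≤ m i<d)))

  potential-suc : ∀ {i} n → i ℕ.< d → special i n ℕ.+ potential i n ≡ potential (suc i) n
  potential-suc {i} n i<d with ℕ.≤-<-connex n i
  -- The new entry is a forced zero, and both potentials equal `n * d`.
  ... | inj₁ n≤i
    rewrite ℕ.m≤n⇒m∸n≡0 n≤i | ℕ.m≤n⇒m∸n≡0 (ℕ.m≤n⇒m≤1+n n≤i)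
          | ℕ.m≥n⇒m⊓n≡n n≤i | ℕ.m≥n⇒m⊓n≡n (ℕ.m≤n⇒m≤1+n n≤i) = ≡.refl
  ... | inj₂ i<n with ℕ.m≤n⇒∃[o]m+o≡n i<n
  ... | k , ≡.refl
    rewrite ℕ.m≤n⇒m⊓n≡m (ℕ.<⇒≤ i<n) | ℕ.m≤n⇒m⊓n≡m (ℕ.s≤s⁻¹ i<n)
          | ≡.sym (ℕ.+-suc i k) | ℕ.m+n∸m≡n i (suc k)
          | ℕ.+-suc i k | ℕ.m+n∸m≡n i k with k ℕ.<? m
  -- The second factor drops by one, so its `i` copies release exactly the `i` that `d ∸ i` lacks.
  ... | yes k<m rewrite ℕ.m≤n⇒m⊓n≡m k<m | ℕ.m≤n⇒m⊓n≡m (ℕ.<⇒≤ k<m) = begin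
        (d ∸ i) ℕ.+ k ℕ.+ i * (d ℕ.+ suc k)
          ≡⟨ solve 4 (λ D k i d → D :+ k :+ i :* (d :+ (con 1 :+ k)) := (D :+ i) :+ k :+ i :* (d :+ k))
               ≡.refl (d ∸ i) k i d ⟩
        (d ∸ i) ℕ.+ i ℕ.+ k ℕ.+ i * (d ℕ.+ k)
          ≡⟨ cong (λ e → e ℕ.+ k ℕ.+ i * (d ℕ.+ k)) (ℕ.m∸n+n≡m (ℕ.<⇒≤ i<d)) ⟩
        d ℕ.+ k ℕ.+ i * (d ℕ.+ k) ∎
    where open ≡-Reasoning
          open +-*-Solver
  -- The new entry is `d + m`, and both second factors are capped at that value.
  ... | no  k≮m rewrite ℕ.m≥n⇒m⊓n≡n (ℕ.m≤n⇒m≤1+n (ℕ.≮⇒≥ k≮m)) | ℕ.m≥n⇒m⊓n≡n (ℕ.≮⇒≥ k≮m) = ≡.refl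

  potential-last : ∀ {n} → n ≤ d ℕ.+ m → potential d n ≡ d * n
  potential-last {n} n≤d+m with ℕ.≤-total n d
  ... | inj₁ n≤d rewrite ℕ.m≤n⇒m∸n≡0 n≤d | ℕ.m≥n⇒m⊓n≡n n≤d | ℕ.+-identityʳ d = ℕ.*-comm n d
  ... | inj₂ d≤n rewrite ℕ.m≤n⇒m⊓n≡m d≤n
                       | ℕ.m≤n⇒m⊓n≡m (subst (n ∸ d ≤_) (ℕ.m+n∸m≡n d m) (ℕ.∸-monoˡ-≤ d n≤d+m))
                       | ℕ.m+[n∸m]≡n d≤n = ≡.refl

  -- U holds in at most one row; the all-empty U gives back the special point.
  record Bump : Set₁ where
    field
      U        : ℕ → ℕ → Set
      U?       : ∀ i n → Dec (U i n)
      interior : ∀ {i n} → U i n → Interior i n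
      unique   : ∀ {i n j k} → U i n → U j k → i ≡ j

    χ : ℕ → ℕ → ℕ
    χ i n = ind (U? i n)

    -- `U i n` moves one unit in column `n` from row `i` to row `i - 1`. By `χ≤special` the
    -- truncated subtraction is exact in the rows of the matrix.
    bumped : ℕ → ℕ → ℕ
    bumped i n = (special i n ℕ.+ χ (suc i) n) ∸ χ i n

    χ≤special : ∀ {i n} → i ℕ.< d → χ i n ≤ special i n
    χ≤special {i} {n} i<d with U? i n
    ... | yes u = special-pos i<d (proj₁ (proj₂ (interior u)))
    ... | no  _ = z≤n

    bumped-special : ∀ {i} n → i ℕ.< d → bumped i n ℕ.+ χ i n ≡ special i n ℕ.+ χ (suc i) n
    bumped-special n i<d = ℕ.m∸n+n≡m (ℕ.≤-trans (χ≤special i<d) (ℕ.m≤m+n _ _))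

    -- The worst case suffices: keep what raises the smaller side and what lowers the larger one,
    -- and discard the rest.
    bumped-≤ : ∀ i n j k → special i n ℕ.+ χ (suc i) n ℕ.+ χ j k ≤ special j k → bumped i n ≤ bumped j k
    bumped-≤ i n j k le = begin
      (special i n ℕ.+ χ (suc i) n) ∸ χ i n  ≤⟨ ℕ.m∸n≤m _ (χ i n) ⟩
      special i n ℕ.+ χ (suc i) n            ≤⟨ ℕ.m+n≤o⇒m≤o∸n _ le ⟩
      special j k ∸ χ j k                    ≤⟨ ℕ.∸-monoˡ-≤ (χ j k) (ℕ.m≤m+n _ _) ⟩
      bumped j k                             ∎
      where open ℕ.≤-Reasoning

    -- `U (suc i) n` raises the left side and `U i (suc n)` lowers the right one. They concern
    -- different rows, so `unique` excludes having both, and `interior` puts either one in the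
    -- strict range.
    bumped-horizontal : ∀ {i} n → i ℕ.< d → bumped i n ≤ bumped i (suc n)
    bumped-horizontal {i} n i<d = bumped-≤ i n i (suc n)
      (gap-absorbs-indicators (U? (suc i) n) (U? i (suc n))
        (λ (u , v) → ℕ.1+n≢n (unique u v))
        [ (λ u → let _ , si<n , n<si+m = interior u in
             special-horizontal-strict i<d (ℕ.<⇒≤ (ℕ.<-trans (ℕ.n<1+n i) si<n)) (ℕ.s≤s⁻¹ n<si+m))
        , (λ u → let _ , i<sn , sn<i+m = interior u in
             special-horizontal-strict i<d (ℕ.s≤s⁻¹ i<sn) (ℕ.<⇒≤ (ℕ.<-trans (ℕ.n<1+n n) sn<i+m))) ]′
        (special-horizontal n i<d))

    -- Here the critical units belong to rows `i + 2` and `i`, which again cannot both occur.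
    bumped-diagonal : ∀ {i} n → i ℕ.< d → bumped (suc i) (suc n) ≤ bumped i n
    bumped-diagonal {i} n i<d = bumped-≤ (suc i) (suc n) i n
      (gap-absorbs-indicators (U? (suc (suc i)) (suc n)) (U? i n)
        (λ (u , v) → ℕ.m+1+n≢n 1 (unique u v))
        [ (λ u → let _ , ssi<sn , sn<ssi+m = interior u in
             special-diagonal-strict i<d (ℕ.<-trans (ℕ.n<1+n i) (ℕ.s≤s⁻¹ ssi<sn)) (ℕ.s≤s⁻¹ (ℕ.s≤s⁻¹ sn<ssi+m)))
        , (λ u → let _ , i<n , n<i+m = interior u in
             special-diagonal-strict i<d i<n (ℕ.<⇒≤ n<i+m)) ]′
        (special-diagonal i n))

    χ-first : ∀ i → χ i 0 ≡ 0
    χ-first i = ind-no (U? i 0) (λ u → ℕ.n≮0 (proj₁ (proj₂ (interior u))))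

    χ-last : ∀ i → χ i (d ℕ.+ m) ≡ 0
    χ-last i = ind-no (U? i _) (λ u → let (_ , i<d) , _ , N<i+m = interior u in
      ℕ.<⇒≱ N<i+m (ℕ.+-monoˡ-≤ m (ℕ.<⇒≤ i<d)))

    χ-top : ∀ n → χ 0 n ≡ 0
    χ-top n = ind-no (U? 0 n) (λ u → ℕ.n≮0 (proj₁ (proj₁ (interior u))))

    χ-bottom : ∀ n → χ d n ≡ 0
    χ-bottom n = ind-no (U? d n) (λ u → ℕ.<-irrefl ≡.refl (proj₂ (proj₁ (interior u))))

    bumped-first : ∀ i → bumped i 0 ≡ 0
    bumped-first i rewrite special-first i | χ-first i | χ-first (suc i) = ≡.refl

    bumped-last : ∀ {i} → i ℕ.< d → bumped i (d ℕ.+ m) ≡ d ℕ.+ m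
    bumped-last {i} i<d rewrite special-last i<d | χ-last i | χ-last (suc i) = ℕ.+-identityʳ _

    -- The first `i` entries of a bumped column sum to `potential i n + χ i n`: a surplus gained in
    -- row `i - 1` is cancelled in row `i`. This is the recursion step of that sum.
    bumped-potential : ∀ {i} n → i ℕ.< d →
      bumped i n ℕ.+ (potential i n ℕ.+ χ i n) ≡ potential (suc i) n ℕ.+ χ (suc i) n
    bumped-potential {i} n i<d = begin
      b ℕ.+ (p ℕ.+ x)   ≡⟨ solve 3 (λ b p x → b :+ (p :+ x) := p :+ (b :+ x)) ≡.refl b p x ⟩
      p ℕ.+ (b ℕ.+ x)   ≡⟨ cong (p ℕ.+_) (bumped-special n i<d) ⟩
      p ℕ.+ (s ℕ.+ x⁺)  ≡⟨ solve 3 (λ p s x → p :+ (s :+ x) := (s :+ p) :+ x) ≡.refl p s x⁺ ⟩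
      (s ℕ.+ p) ℕ.+ x⁺  ≡⟨ cong (ℕ._+ x⁺) (potential-suc n i<d) ⟩
      potential (suc i) n ℕ.+ x⁺ ∎
      where
      open ≡-Reasoning
      open +-*-Solver
      b = bumped i n
      p = potential i n
      x = χ i n
      x⁺ = χ (suc i) n
      s = special i n

  -- Enumeration of the interior positions.

  Size : ℕ
  Size = (d ∸ 1) * (m ∸ 1)

  row : Fin Size → ℕ
  row t = suc (toℕ (quotient {d ∸ 1} (m ∸ 1) t))

  -- Measuring columns from the row turns the slanted interior region into a rectangle; the offsets
  -- by one skip row 0 and the forced zero at column `row t`.
  col : Fin Size → ℕ
  col t = row t ℕ.+ suc (toℕ (remainder {d ∸ 1} (m ∸ 1) t))

  index-injective : ∀ {s t} → row s ≡ row t → col s ≡ col t → s ≡ t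
  index-injective {s} {t} rows cols = begin
    s                                   ≡⟨ Fin.combine-remQuot {d ∸ 1} (m ∸ 1) s ⟨
    combine (quotient {d ∸ 1} (m ∸ 1) s) (remainder {d ∸ 1} (m ∸ 1) s)
      ≡⟨ cong₂ combine (Fin.toℕ-injective (ℕ.suc-injective rows))
           (Fin.toℕ-injective (ℕ.suc-injective (ℕ.+-cancelˡ-≡ (row t) _ _
             (≡.trans (cong (ℕ._+ suc (toℕ (remainder {d ∸ 1} (m ∸ 1) s))) (≡.sym rows)) cols)))) ⟩
    combine (quotient {d ∸ 1} (m ∸ 1) t) (remainder {d ∸ 1} (m ∸ 1) t)
      ≡⟨ Fin.combine-remQuot {d ∸ 1} (m ∸ 1) t ⟩
    t ∎
    where open ≡-Reasoning

  index-interior : ∀ t → Interior (row t) (col t)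
  index-interior t =
    (s≤s z≤n , <pred (Fin.toℕ<n (quotient {d ∸ 1} (m ∸ 1) t))) ,
    ℕ.m<m+n (row t) (s≤s z≤n) ,
    ℕ.+-monoʳ-< (row t) (<pred (Fin.toℕ<n (remainder {d ∸ 1} (m ∸ 1) t)))
    where
    <pred : ∀ {x y} → x ℕ.< y ∸ 1 → suc x ℕ.< y
    <pred {x} {suc y} x<y = s≤s x<y

  col<1+N : ∀ t → col t ℕ.< suc (d ℕ.+ m)
  col<1+N t = let (_ , i<d) , _ , n<i+m = index-interior t in
    ℕ.<-trans n<i+m (s≤s (ℕ.+-monoˡ-≤ m (ℕ.<⇒≤ i<d)))

  index-surjective : ∀ i n → Interior i n → ∃[ t ] (row t ≡ i × col t ≡ n)
  index-surjective (suc i) n ((_ , i<d) , i<n , n<i+m) with ℕ.m≤n⇒∃[o]m+o≡n i<n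
  ... | k , ≡.refl = combine i′ k′ , row≡ , col≡
    where
    i<p : i ℕ.< d ∸ 1
    i<p = ℕ.∸-monoˡ-≤ 1 i<d
    k<q : k ℕ.< m ∸ 1
    k<q = ℕ.∸-monoˡ-≤ 1 (ℕ.+-cancelˡ-< (suc i) (suc k) m (subst (ℕ._< suc i ℕ.+ m) (≡.sym (ℕ.+-suc (suc i) k)) n<i+m))
    i′ = fromℕ< i<p
    k′ = fromℕ< k<q
    row≡ : row (combine i′ k′) ≡ suc i
    row≡ = cong suc (≡.trans (cong (toℕ ∘ proj₁) (Fin.remQuot-combine i′ k′)) (Fin.toℕ-fromℕ< i<p))
    col≡ : col (combine i′ k′) ≡ suc (suc i) ℕ.+ k
    col≡ = ≡.trans (cong₂ (λ x y → x ℕ.+ suc y) row≡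
             (≡.trans (cong (toℕ ∘ proj₂) (Fin.remQuot-combine i′ k′)) (Fin.toℕ-fromℕ< k<q)))
             (ℕ.+-suc (suc i) k)

  Index : Fin Size → ℕ → ℕ → Set
  Index t i n = row t ≡ i × col t ≡ n

  index? : ∀ t i n → Dec (Index t i n)
  index? t i n = (row t ℕ.≟ i) ×-dec (col t ℕ.≟ n)

  noBump : Bump
  noBump = record { U = λ _ _ → ⊥ ; U? = λ _ _ → no λ () ; interior = λ () ; unique = λ () }

  bumpAt : Fin Size → Bump
  bumpAt t = record
    { U        = Index t
    ; U?       = index? t
    ; interior = λ { (≡.refl , ≡.refl) → index-interior t }
    ; unique   = λ (p , _) (q , _) → ≡.trans (≡.sym p) q
    }

-- Consequences of the ordered field axioms.

module Dimension {c ℓ₁ ℓ₂ ℓ₃} (R : RealNumbers c ℓ₁ ℓ₂ ℓ₃) where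
  open RealNumbers R hiding (_≤_; _*_) renaming (_<_ to _<ʳ_)
  open RealNumbers R using () renaming (_≤_ to _≤ʳ_; _*_ to _·_)

  private
    module CR = CommutativeRing commutativeRing
    module SPO = IsStrictPartialOrder isStrictPartialOrder
  open RingProperties CR.ring
  open CommutativeSemigroupProperties CR.+-commutativeSemigroup using (x∙yz≈y∙xz)
  open SumProperties semiring hiding (sum)
  open MultProperties semiring using (×-homo-+)
  open HeytingProperties heytingCommutativeRing using (1#0)
  open SetoidReasoning CR.setoid

  ≤ʳ-trans : ∀ {x y z} → x ≤ʳ y → y ≤ʳ z → x ≤ʳ z
  ≤ʳ-trans {x} {y} {z} x≤y y≤z z<x with #-cotrans (<⇒# z<x) y
  ... | inj₁ z#y = [ y≤z , (λ y<z → x≤y (SPO.trans y<z z<x)) ]′ (#⇒<⊎> z#y)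
  ... | inj₂ y#x = [ x≤y , (λ x<y → y≤z (SPO.trans z<x x<y)) ]′ (#⇒<⊎> y#x)

  ≤ʳ-antisym : ∀ {x y} → x ≤ʳ y → y ≤ʳ x → x ≈ y
  ≤ʳ-antisym x≤y y≤x = proj₁ (tight _ _) (λ x#y → [ y≤x , x≤y ]′ (#⇒<⊎> x#y))

  ≤ʳ-reflexive : ∀ {x y} → x ≈ y → x ≤ʳ y
  ≤ʳ-reflexive x≈y y<x = SPO.irrefl (sym x≈y) y<x

  0<1 : 0# <ʳ 1#
  0<1 with #⇒<⊎> 1#0
  ... | inj₂ 0<1 = 0<1
  -- If `1 < 0`, then `- 1` is positive and so is its square 1, which is again the goal.
  ... | inj₁ 1<0 = SPO.<-respʳ-≈ -1·-1≈1 (*-pos 0<-1 0<-1)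
    where
    0<-1 : 0# <ʳ - 1#
    0<-1 = SPO.<-respˡ-≈ (-‿inverseʳ 1#) (SPO.<-respʳ-≈ (+-identityˡ (- 1#)) (+-monoˡ-< (- 1#) 1<0))
    -1·-1≈1 : - 1# · - 1# ≈ 1#
    -1·-1≈1 = trans (-1*x≈-x (- 1#)) (-‿involutive 1#)

  ι<ι-suc : ∀ n → ι n <ʳ ι (suc n)
  ι<ι-suc n = SPO.<-respˡ-≈ (+-identityˡ (ι n)) (+-monoˡ-< (ι n) 0<1)

  ι-mono-≤ : ∀ {m n} → m ≤ n → ι m ≤ʳ ι n
  ι-mono-≤ {m} m≤n = go (ℕ.≤⇒≤′ m≤n)
    where
    go : ∀ {n} → m ℕ.≤′ n → ι m ≤ʳ ι n
    go (ℕ.≤′-reflexive ≡.refl) = ≤ʳ-reflexive refl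
    go (ℕ.≤′-step {n} m≤n) ι< = go m≤n (SPO.trans (ι<ι-suc n) ι<)

  ι-homo-+ : ∀ m n → ι (m ℕ.+ n) ≈ ι m + ι n
  ι-homo-+ = ×-homo-+ 1#

  ι-cong : ∀ {m n} → m ≡ n → ι m ≈ ι n
  ι-cong = reflexive ∘ cong ι

  x+y≈z⇒x≈z-y : ∀ {x y z} → x + y ≈ z → x ≈ z - y
  x+y≈z⇒x≈z-y {x} {y} {z} eq = +-cancelʳ y x (z - y) (trans eq (sym (//-rightDividesˡ y z)))

  -- Finite sums and partial sums.

  sum-zero : ∀ {n} (f : Vector ℝ n) → (∀ t → f t ≈ 0#) → sum f ≈ 0#
  sum-zero {n} f f≈0 = trans (sum-cong-≋ f≈0) (sum-replicate-zero n)

  sum-single : ∀ {n} (f : Vector ℝ n) s → (∀ t → ¬ (t ≡ s) → f t ≈ 0#) → sum f ≈ f s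
  sum-single f zero f≈0 = begin
    f zero + sum (tail f)  ≈⟨ +-congˡ (sum-zero (tail f) (λ t → f≈0 (suc t) λ ())) ⟩
    f zero + 0#            ≈⟨ +-identityʳ (f zero) ⟩
    f zero                 ∎
  sum-single f (suc s) f≈0 = begin
    f zero + sum (tail f)  ≈⟨ +-cong (f≈0 zero λ ()) (sum-single (tail f) s (λ t t≢s → f≈0 (suc t) (t≢s ∘ Fin.suc-injective))) ⟩
    0# + f (suc s)         ≈⟨ +-identityˡ (f (suc s)) ⟩
    f (suc s)              ∎

  -- `g` is a candidate for the partial sums, known only by its recursion; it need not start at 0.
  telescope : ∀ {n} (u : Vector ℝ n) (g : ℕ → ℝ) →
    (∀ i → u i + g (toℕ i) ≈ g (suc (toℕ i))) → sum u + g 0 ≈ g n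
  telescope {zero}  u g step = +-identityˡ (g 0)
  telescope {suc n} u g step = begin
    (u zero + sum (tail u)) + g 0  ≈⟨ +-congʳ (+-comm _ _) ⟩
    (sum (tail u) + u zero) + g 0  ≈⟨ +-assoc _ _ _ ⟩
    sum (tail u) + (u zero + g 0)  ≈⟨ +-congˡ (step zero) ⟩
    sum (tail u) + g 1             ≈⟨ telescope (tail u) (g ∘ suc) (step ∘ suc) ⟩
    g (suc n)                      ∎

  -- The cut is a natural number because boundaries run from 0 to the number of rows inclusive; past
  -- the end the value is the whole sum.
  psum : ∀ {n} → ℕ → Vector ℝ n → ℝ
  psum         zero    v = 0#
  psum {zero}  (suc i) v = 0#
  psum {suc n} (suc i) v = v zero + psum i (tail v)

  psum-suc : ∀ {n} (v : Vector ℝ n) i → v i + psum (toℕ i) v ≈ psum (suc (toℕ i)) v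
  psum-suc v zero    = refl
  psum-suc v (suc i) = trans (x∙yz≈y∙xz _ _ _) (+-congˡ (psum-suc (tail v) i))

  psum-zero : ∀ {n} i (v : Vector ℝ n) → (∀ j → toℕ j ℕ.< i → v j ≈ 0#) → psum i v ≈ 0#
  psum-zero         zero    v v≈0 = refl
  psum-zero {zero}  (suc i) v v≈0 = refl
  psum-zero {suc n} (suc i) v v≈0 =
    trans (+-cong (v≈0 zero (s≤s z≤n)) (psum-zero i (tail v) (λ j j<i → v≈0 (suc j) (s≤s j<i))))
          (+-identityˡ 0#)

  psum-full : ∀ {n} i (v : Vector ℝ n) → (∀ j → i ≤ toℕ j → v j ≈ 0#) → psum i v ≈ sum v
  psum-full         zero    v v≈0 = sym (sum-zero v (λ j → v≈0 j z≤n))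
  psum-full {zero}  (suc i) v v≈0 = refl
  psum-full {suc n} (suc i) v v≈0 = +-congˡ (psum-full i (tail v) (λ j i≤j → v≈0 (suc j) (s≤s i≤j)))

  sum-affine : ∀ {k} (a f : Vector ℝ k) x → sum a ≈ 1# → (∀ t → f t ≈ x) → sum (λ t → a t · f t) ≈ x
  sum-affine a f x Σa≈1 f≈x = begin
    sum (λ t → a t · f t)  ≈⟨ sum-cong-≋ (λ t → *-congˡ (f≈x t)) ⟩
    sum (λ t → a t · x)    ≈⟨ *-distribʳ-sum x a ⟨
    sum a · x              ≈⟨ *-congʳ Σa≈1 ⟩
    1# · x                 ≈⟨ *-identityˡ x ⟩
    x                      ∎

  module _ (d m : ℕ) where
    open Eigensteps d m

    Polytope : Matrix R d (suc (d ℕ.+ m)) → Set (ℓ₁ ⊔ ℓ₃)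
    Polytope = Λ R (d ℕ.+ m) d

    Entries : Set c
    Entries = Matrix R d (suc (d ℕ.+ m))

    -- Entries forced by the inequalities.

    module _ {M : Entries} (M∈Λ : Polytope M) where
      open Λ M∈Λ

      entry≥0 : ∀ n i → 0# ≤ʳ M i n
      entry≥0 = <-weakInduction _ (λ i → ≤ʳ-reflexive (sym (firstColumn i)))
        (λ n ih i → ≤ʳ-trans (ih i) (horizontal i n))

      entry≤N : ∀ n i → M i n ≤ʳ ι (d ℕ.+ m)
      entry≤N = >-weakInduction _ (λ i → ≤ʳ-reflexive (lastColumn i))
        (λ n ih i → ≤ʳ-trans (horizontal i n) (ih i))

      -- The diagonal inequality leads up and left; as `n ≤ i`, column 0 is reached without leaving
      -- the matrix.
      entry≤0 : ∀ n i → toℕ n ≤ toℕ i → M i n ≤ʳ 0#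
      entry≤0 = <-weakInduction _ (λ i _ → ≤ʳ-reflexive (firstColumn i)) step
        where
        step : ∀ n → (∀ i → toℕ (inject₁ n) ≤ toℕ i → M i (inject₁ n) ≤ʳ 0#) →
               ∀ i → suc (toℕ n) ≤ toℕ i → M i (suc n) ≤ʳ 0#
        step n ih (suc i) (s≤s n≤i) = ≤ʳ-trans
          (diagonal (suc i) (inject₁ i) (cong suc (≡.sym (Fin.toℕ-inject₁ i))) n)
          (ih (inject₁ i) (≡.subst₂ _≤_ (≡.sym (Fin.toℕ-inject₁ n)) (≡.sym (Fin.toℕ-inject₁ i)) n≤i))

      -- Read backwards, the diagonal inequality leads down and right to the last column, preserving
      -- `m + i < n`.
      entry≥N : ∀ n i → m ℕ.+ toℕ i ℕ.< toℕ n → ι (d ℕ.+ m) ≤ʳ M i n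
      entry≥N = >-weakInduction _ (λ i _ → ≤ʳ-reflexive (sym (lastColumn i))) step
        where
        step : ∀ n → (∀ i → m ℕ.+ toℕ i ℕ.< suc (toℕ n) → ι (d ℕ.+ m) ≤ʳ M i (suc n)) →
               ∀ i → m ℕ.+ toℕ i ℕ.< toℕ (inject₁ n) → ι (d ℕ.+ m) ≤ʳ M i (inject₁ n)
        step n ih i m+i<n = ≤ʳ-trans
          (ih i⁺ (subst (λ j → m ℕ.+ j ℕ.< suc (toℕ n)) (≡.sym i⁺≡)
                   (subst (ℕ._< suc (toℕ n)) (≡.sym (ℕ.+-suc m (toℕ i))) (s≤s m+i<n′))))
          (diagonal i⁺ i i⁺≡ n)
          where
          m+i<n′ : m ℕ.+ toℕ i ℕ.< toℕ n
          m+i<n′ = subst (m ℕ.+ toℕ i ℕ.<_) (Fin.toℕ-inject₁ n) m+i<n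
          -- The next row exists because `m + i < n < d + m`.
          1+i<d : suc (toℕ i) ℕ.< d
          1+i<d = ℕ.+-cancelˡ-< m _ _ (≡.subst₂ ℕ._<_ (≡.sym (ℕ.+-suc m (toℕ i))) (ℕ.+-comm d m)
                    (ℕ.≤-<-trans m+i<n′ (Fin.toℕ<n n)))
          i⁺ = fromℕ< 1+i<d
          i⁺≡ = Fin.toℕ-fromℕ< 1+i<d

      entry-0 : ∀ i n → toℕ n ≤ toℕ i → M i n ≈ 0#
      entry-0 i n n≤i = ≤ʳ-antisym (entry≤0 n i n≤i) (entry≥0 n i)

      entry-N : ∀ i n → m ℕ.+ toℕ i ℕ.< toℕ n → M i n ≈ ι (d ℕ.+ m)
      entry-N i n m+i<n = ≤ʳ-antisym (entry≤N n i) (entry≥N n i m+i<n)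

    -- Equations that pass to the affine hull, as the coefficients sum to 1.

    hull-entry : ∀ {x i n z} → AffineHull R Polytope x → (∀ {M} → Polytope M → M i n ≈ z) → x i n ≈ z
    hull-entry {i = i} {n} {z} (k , a , p , p∈ , Σa , x≈) const =
      trans (x≈ i n) (sum-affine a (λ t → p t i n) z Σa (λ t → const (p∈ t)))

    hull-columnSum : ∀ {x} n → AffineHull R Polytope x → sum (λ i → x i n) ≈ ι (d * toℕ n)
    hull-columnSum {x} n (k , a , p , p∈ , Σa , x≈) = begin
      sum (λ i → x i n)                          ≈⟨ sum-cong-≋ (λ i → x≈ i n) ⟩
      sum (λ i → sum (λ t → a t · p t i n))      ≈⟨ ∑-comm (λ i t → a t · p t i n) ⟩
      sum (λ t → sum (λ i → a t · p t i n))      ≈⟨ sum-cong-≋ (λ t → *-distribˡ-sum (a t) (λ i → p t i n)) ⟨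
      sum (λ t → a t · sum (λ i → p t i n))
        ≈⟨ sum-affine a (λ t → sum (λ i → p t i n)) _ Σa (λ t → Λ.columnSum (p∈ t) n) ⟩
      ι (d * toℕ n)                              ∎

    -- Bumped points in the polytope.

    module _ (B : Bump) where
      open Bump B

      bumped∈Λ : Polytope (λ i n → ι (bumped (toℕ i) (toℕ n)))
      bumped∈Λ = record
        { firstColumn = λ i → ι-cong (bumped-first (toℕ i))
        ; lastColumn  = λ i → ι-cong (≡.trans (cong (bumped (toℕ i)) (Fin.toℕ-fromℕ (d ℕ.+ m))) (bumped-last (Fin.toℕ<n i)))
        ; columnSum   = columnSum
        ; horizontal  = λ i n → ι-mono-≤ (subst (λ j → bumped (toℕ i) j ≤ bumped (toℕ i) (suc (toℕ n)))
                          (≡.sym (Fin.toℕ-inject₁ n)) (bumped-horizontal (toℕ n) (Fin.toℕ<n i)))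
        ; diagonal    = λ i i⁻ i≡ n → ι-mono-≤ (≡.subst₂ (λ j k → bumped j (suc (toℕ n)) ≤ bumped (toℕ i⁻) k)
                          (≡.sym i≡) (≡.sym (Fin.toℕ-inject₁ n)) (bumped-diagonal (toℕ n) (Fin.toℕ<n i⁻)))
        }
        where
        columnSum : ∀ (n : Fin (suc (d ℕ.+ m))) → sum (λ (i : Fin d) → ι (bumped (toℕ i) (toℕ n))) ≈ ι (d * toℕ n)
        columnSum n = begin
          sum u        ≈⟨ +-identityʳ (sum u) ⟨
          sum u + 0#   ≈⟨ +-congˡ (ι-cong (χ-top (toℕ n))) ⟨
          sum u + g 0  ≈⟨ telescope u g (λ i → trans (sym (ι-homo-+ (bumped (toℕ i) (toℕ n)) _))
                                                   (ι-cong (bumped-potential (toℕ n) (Fin.toℕ<n i)))) ⟩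
          g d          ≈⟨ ι-cong (≡.trans (cong (potential d (toℕ n) ℕ.+_) (χ-bottom (toℕ n))) (ℕ.+-identityʳ _)) ⟩
          ι (potential d (toℕ n)) ≈⟨ ι-cong (potential-last (ℕ.s≤s⁻¹ (Fin.toℕ<n n))) ⟩
          ι (d * toℕ n) ∎
          where
          u : Vector ℝ d
          u i = ι (bumped (toℕ i) (toℕ n))
          -- The partial sums of the column: `g 0` vanishes, and `χ d` vanishes, so the total is
          -- `potential d`.
          g : ℕ → ℝ
          g i = ι (potential i (toℕ n) ℕ.+ χ i (toℕ n))

    base : Entries
    base i n = ι (Bump.bumped noBump (toℕ i) (toℕ n))

    base∈Λ : Polytope base
    base∈Λ = bumped∈Λ noBump

    perturbed : Vector Entries Size
    perturbed t i n = ι (Bump.bumped (bumpAt t) (toℕ i) (toℕ n))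

    perturbed∈Λ : ∀ t → Polytope (perturbed t)
    perturbed∈Λ t = bumped∈Λ (bumpAt t)

    -- Basis vectors and their coefficients.

    indicator : Fin Size → ℕ → ℕ → ℝ
    indicator t i n = ι (Bump.χ (bumpAt t) i n)

    basis : Vector Entries Size
    basis t i n = indicator t (suc (toℕ i)) (toℕ n) - indicator t (toℕ i) (toℕ n)

    perturbed≈base+basis : ∀ t i n → perturbed t i n ≈ base i n + basis t i n
    perturbed≈base+basis t i n = begin
      perturbed t i n ≈⟨ x+y≈z⇒x≈z-y (begin
        perturbed t i n + indicator t (toℕ i) (toℕ n)  ≈⟨ ι-homo-+ (Bump.bumped (bumpAt t) (toℕ i) (toℕ n)) _ ⟨
        ι (Bump.bumped (bumpAt t) (toℕ i) (toℕ n) ℕ.+ Bump.χ (bumpAt t) (toℕ i) (toℕ n))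
          ≈⟨ ι-cong (Bump.bumped-special (bumpAt t) (toℕ n) (Fin.toℕ<n i)) ⟩
        ι (special (toℕ i) (toℕ n) ℕ.+ Bump.χ (bumpAt t) (suc (toℕ i)) (toℕ n))
          ≈⟨ ι-homo-+ (special (toℕ i) (toℕ n)) _ ⟩
        ι (special (toℕ i) (toℕ n)) + indicator t (suc (toℕ i)) (toℕ n)
          -- For the empty bump both indicators compute to 0, so only a summand 0 has to be removed
          -- from `base`.
          ≈⟨ +-congʳ (ι-cong (ℕ.+-identityʳ (special (toℕ i) (toℕ n)))) ⟨
        base i n + indicator t (suc (toℕ i)) (toℕ n)  ∎) ⟩
      (base i n + indicator t (suc (toℕ i)) (toℕ n)) - indicator t (toℕ i) (toℕ n)  ≈⟨ +-assoc _ _ _ ⟩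
      base i n + basis t i n ∎

    coefficient : Vector ℝ Size → ℕ → ℕ → ℝ
    coefficient a i n = sum (λ t → a t · indicator t i n)

    coefficient-at : ∀ a s {i n} → Index s i n → coefficient a i n ≈ a s
    coefficient-at a s {i} {n} s∼ = begin
      coefficient a i n  ≈⟨ sum-single (λ t → a t · indicator t i n) s (λ t t≢s → trans
                              (*-congˡ (ι-cong (ind-no (index? t i n) (λ t∼ → t≢s (index-injective
                                (≡.trans (proj₁ t∼) (≡.sym (proj₁ s∼))) (≡.trans (proj₂ t∼) (≡.sym (proj₂ s∼))))))))
                              (CR.zeroʳ (a t))) ⟩
      a s · indicator s i n      ≈⟨ *-congˡ (trans (ι-cong (ind-yes (index? s i n) s∼)) (+-identityʳ 1#)) ⟩
      a s · 1#           ≈⟨ *-identityʳ (a s) ⟩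
      a s                ∎

    coefficient-outside : ∀ a i n → ¬ Interior i n → coefficient a i n ≈ 0#
    coefficient-outside a i n outside = sum-zero _ (λ t → trans
      (*-congˡ (ι-cong (ind-no (index? t i n) (λ { (≡.refl , ≡.refl) → outside (index-interior t) }))))
      (CR.zeroʳ (a t)))

    -- Each basis vector is the row difference of its indicator, so `coefficient` gives the partial
    -- column sums of the combination.
    combination-coefficient : ∀ a i n →
      combination R a basis i n + coefficient a (toℕ i) (toℕ n) ≈ coefficient a (suc (toℕ i)) (toℕ n)
    combination-coefficient a i n = begin
      combination R a basis i n + coefficient a (toℕ i) (toℕ n)
        ≈⟨ ∑-distrib-+ (λ t → a t · basis t i n) (λ t → a t · indicator t (toℕ i) (toℕ n)) ⟨
      sum (λ t → a t · basis t i n + a t · indicator t (toℕ i) (toℕ n))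
        ≈⟨ sum-cong-≋ (λ t → trans (sym (CR.distribˡ (a t) (basis t i n) (indicator t (toℕ i) (toℕ n))))
                                   (*-congˡ (//-rightDividesˡ (indicator t (toℕ i) (toℕ n)) (indicator t (suc (toℕ i)) (toℕ n))))) ⟩
      coefficient a (suc (toℕ i)) (toℕ n) ∎

    -- A vanishing combination makes `coefficient` constant down each column, and it starts at zero.
    basis-independent : LinearlyIndependent R basis
    basis-independent a comb≈0 t = trans (sym (coefficient-at a t (≡.refl , ≡.refl)))
      (vanish (row t) (ℕ.<⇒≤ (proj₂ (proj₁ (index-interior t)))))
      where
      n = fromℕ< (col<1+N t)
      vanish : ∀ i → i ≤ d → coefficient a i (col t) ≈ 0#
      vanish zero    _   = coefficient-outside a 0 (col t) (λ ((0<0 , _) , _) → ℕ.n≮0 0<0)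
      vanish (suc i) i<d = begin
        coefficient a (suc i) (col t)
          ≡⟨ cong₂ (λ j k → coefficient a (suc j) k) (Fin.toℕ-fromℕ< i<d) (Fin.toℕ-fromℕ< (col<1+N t)) ⟨
        coefficient a (suc (toℕ j)) (toℕ n)            ≈⟨ combination-coefficient a j n ⟨
        combination R a basis j n + coefficient a (toℕ j) (toℕ n)
          ≈⟨ +-cong (comb≈0 j n) (reflexive (cong₂ (coefficient a) (Fin.toℕ-fromℕ< i<d) (Fin.toℕ-fromℕ< (col<1+N t)))) ⟩
        0# + coefficient a i (col t)                   ≈⟨ +-identityˡ _ ⟩
        coefficient a i (col t)                        ≈⟨ vanish i (ℕ.<⇒≤ i<d) ⟩
        0#                                             ∎
        where j = fromℕ< i<d

    -- The direction space as the solutions of homogeneous equations.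

    record Homogeneous (v : Entries) : Set ℓ₁ where
      field
        left  : ∀ i n → toℕ n ≤ toℕ i → v i n ≈ 0#
        right : ∀ i n → m ℕ.+ toℕ i ℕ.< toℕ n → v i n ≈ 0#
        total : ∀ n → sum (λ i → v i n) ≈ 0#

    direction-homogeneous : ∀ {v} → Direction R (AffineHull R Polytope) v → Homogeneous v
    direction-homogeneous {v} (x , y , x∈ , y∈ , v≈y-x) = record
      { left  = λ i n n≤i → difference i n (λ M∈Λ → entry-0 M∈Λ i n n≤i)
      ; right = λ i n m+i<n → difference i n (λ M∈Λ → entry-N M∈Λ i n m+i<n)
      ; total = λ n → +-identityˡ-unique _ _ (begin
          sum (λ i → v i n) + ι (d * toℕ n)          ≈⟨ +-congˡ (hull-columnSum n x∈) ⟨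
          sum (λ i → v i n) + sum (λ i → x i n)      ≈⟨ ∑-distrib-+ (λ i → v i n) (λ i → x i n) ⟨
          sum (λ i → v i n + x i n)                  ≈⟨ sum-cong-≋ (λ i → trans (+-congʳ (v≈y-x i n)) (//-rightDividesˡ _ _)) ⟩
          sum (λ i → y i n)                          ≈⟨ hull-columnSum n y∈ ⟩
          ι (d * toℕ n)                              ∎)
      }
      where
      difference : ∀ i n {z} → (∀ {M} → Polytope M → M i n ≈ z) → v i n ≈ 0#
      difference i n {z} const = begin
        v i n          ≈⟨ v≈y-x i n ⟩
        y i n - x i n  ≈⟨ +-cong (hull-entry y∈ const) (-‿cong (hull-entry x∈ const)) ⟩
        z - z          ≈⟨ -‿inverseʳ z ⟩
        0#             ∎

    -- Once `v` and the combination have the same partial column sums, they agree entry by entry.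
    homogeneous⇒span : ∀ {v} → Homogeneous v → Span R basis v
    homogeneous⇒span {v} hom = a , λ i n → +-cancelʳ (coefficient a (toℕ i) (toℕ n)) _ _ (begin
      v i n + coefficient a (toℕ i) (toℕ n)  ≈⟨ +-congˡ (coefficient≈psum n (ℕ.<⇒≤ (Fin.toℕ<n i))) ⟩
      v i n + psum (toℕ i) (λ j → v j n)     ≈⟨ psum-suc (λ j → v j n) i ⟩
      psum (suc (toℕ i)) (λ j → v j n)       ≈⟨ coefficient≈psum n (Fin.toℕ<n i) ⟨
      coefficient a (suc (toℕ i)) (toℕ n)    ≈⟨ combination-coefficient a i n ⟨
      combination R a basis i n + coefficient a (toℕ i) (toℕ n) ∎)
      where
      open Homogeneous hom
      a : Vector ℝ Size
      -- The choice is forced, since `coefficient` must equal the partial column sum.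
      a t = psum (row t) (λ j → v j (fromℕ< (col<1+N t)))

      -- For `i = 0` the sum is empty and for `i = d` it is the whole column. If `n ≤ i`, the
      -- omitted entries vanish, leaving the column total; if `n ≥ i + m`, all summed entries
      -- vanish.
      psum-outside : ∀ {i} n → i ≤ d → ¬ Interior i (toℕ n) → psum i (λ j → v j n) ≈ 0#
      psum-outside {i} n i≤d outside with 0 ℕ.<? i | i ℕ.<? d | i ℕ.<? toℕ n | toℕ n ℕ.<? i ℕ.+ m
      ... | no 0≮i | _ | _ | _ = psum-zero i _ (λ j j<i → contradiction (ℕ.≤-<-trans z≤n j<i) 0≮i)
      ... | _ | no i≮d | _ | _ = trans (psum-full i _ (λ j i≤j → contradiction (ℕ.≤-<-trans i≤j (Fin.toℕ<n j)) i≮d)) (total n)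
      ... | _ | _ | no i≮n | _ = trans (psum-full i _ (λ j i≤j → left j n (ℕ.≤-trans (ℕ.≮⇒≥ i≮n) i≤j))) (total n)
      ... | _ | _ | _ | no n≮i+m = psum-zero i _ (λ j j<i → right j n (ℕ.<-≤-trans
              (subst (ℕ._< i ℕ.+ m) (ℕ.+-comm (toℕ j) m) (ℕ.+-monoˡ-< m j<i)) (ℕ.≮⇒≥ n≮i+m)))
      ... | yes p | yes q | yes r | yes s = contradiction ((p , q) , r , s) outside

      interior? : ∀ i n → Dec (Interior i n)
      interior? i n = ((0 ℕ.<? i) ×-dec (i ℕ.<? d)) ×-dec ((i ℕ.<? n) ×-dec (n ℕ.<? i ℕ.+ m))

      coefficient≈psum : ∀ {i} n → i ≤ d → coefficient a i (toℕ n) ≈ psum i (λ j → v j n)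
      coefficient≈psum {i} n i≤d with interior? i (toℕ n)
      ... | no outside = trans (coefficient-outside a i (toℕ n) outside) (sym (psum-outside n i≤d outside))
      ... | yes inside with index-surjective i (toℕ n) inside
      ... | t , row≡ , col≡ = trans (coefficient-at a t (row≡ , col≡))
              (reflexive (cong₂ (λ k l → psum k (λ j → v j l)) row≡
                (Fin.toℕ-injective (≡.trans (Fin.toℕ-fromℕ< (col<1+N t)) col≡))))

    span⇒direction : ∀ {v} → Span R basis v → Direction R (AffineHull R Polytope) v
    span⇒direction {v} (a , v≈) = base , (λ i n → v i n + base i n) , base∈hull , translate∈hull ,
      (λ i n → x+y≈z⇒x≈z-y refl)
      where
      base∈hull : AffineHull R Polytope base
      base∈hull = 1 , (λ _ → 1#) , (λ _ → base) , (λ _ → base∈Λ) , +-identityʳ 1# ,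
        (λ i n → sym (trans (+-identityʳ _) (*-identityˡ (base i n))))
      translate∈hull : AffineHull R Polytope (λ i n → v i n + base i n)
      -- The weight `1 - sum a` on `base` completes the coefficients to 1; as `perturbed t` is
      -- `base + basis t`, the combination is `base + v`.
      translate∈hull = suc Size , ((1# - sum a) ∷ a) , (base ∷ perturbed) ,
        (λ { zero → base∈Λ ; (suc t) → perturbed∈Λ t }) , //-rightDividesˡ (sum a) 1# , expand
        where
        expand : ∀ i n → v i n + base i n ≈ (1# - sum a) · base i n + sum (λ t → a t · perturbed t i n)
        expand i n = sym (begin
          (1# - sum a) · b + sum (λ t → a t · perturbed t i n)
            ≈⟨ +-congˡ (sum-cong-≋ (λ t → trans (*-congˡ (perturbed≈base+basis t i n)) (CR.distribˡ (a t) b (basis t i n)))) ⟩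
          (1# - sum a) · b + sum (λ t → a t · b + a t · basis t i n)
            ≈⟨ +-congˡ (∑-distrib-+ (λ t → a t · b) (λ t → a t · basis t i n)) ⟩
          (1# - sum a) · b + (sum (λ t → a t · b) + combination R a basis i n)
            ≈⟨ +-assoc _ _ _ ⟨
          ((1# - sum a) · b + sum (λ t → a t · b)) + combination R a basis i n
            ≈⟨ +-cong (+-congˡ (sym (*-distribʳ-sum b a))) (sym (v≈ i n)) ⟩
          ((1# - sum a) · b + sum a · b) + v i n
            ≈⟨ +-congʳ (CR.distribʳ b (1# - sum a) (sum a)) ⟨
          ((1# - sum a) + sum a) · b + v i n
            ≈⟨ +-congʳ (trans (*-congʳ (//-rightDividesˡ (sum a) 1#)) (*-identityˡ b)) ⟩
          b + v i n  ≈⟨ +-comm b (v i n) ⟩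
          v i n + b  ∎)
          where b = base i n

    dimension : HasDim R Polytope Size
    dimension = basis , basis-independent , homogeneous⇒span ∘ direction-homogeneous , span⇒direction

-- From `d + m` to `N`, with the degenerate cases.

theorem3p2 : ∀ {c ℓ₁ ℓ₂ ℓ₃} (R : RealNumbers c ℓ₁ ℓ₂ ℓ₃) (N d : ℕ) → d ≤ N →
    ((d ≡ 0 ⊎ d ≡ N) → HasDim R (Λ R N d) 0) ×
    (¬ (d ≡ 0 ⊎ d ≡ N) → HasDim R (Λ R N d) ((d ∸ 1) * (N ∸ d ∸ 1)))
theorem3p2 R N d d≤N =
  -- Truncated subtraction makes the general formula 0 here: by computation for `d = 0`, and by
  -- `degenerate` for `d = N`.
  (λ { (inj₁ ≡.refl) → dim
     ; (inj₂ ≡.refl) → subst (HasDim R (Λ R N d)) (degenerate d) dim }) ,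
  λ _ → dim
  where
  dim : HasDim R (Λ R N d) ((d ∸ 1) * (N ∸ d ∸ 1))
  dim = subst (λ N′ → HasDim R (Λ R N′ d) ((d ∸ 1) * (N ∸ d ∸ 1))) (ℕ.m+[n∸m]≡n d≤N)
          (Dimension.dimension R d (N ∸ d))
  degenerate : ∀ d → (d ∸ 1) * (d ∸ d ∸ 1) ≡ 0
  degenerate d rewrite ℕ.n∸n≡0 d = ℕ.*-zeroʳ (d ∸ 1)
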